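{- Let $k > d \geq 1$ be integers. There is a function $f = f_{k,d} : \mathbb{N} \to \mathbb{R}$ with $f(N) \to 0$ as $N \to \infty$ such that for every even positive integer $n$, setting $N = (k-1)n - k + 2$, there exists an $N$-vertex $k$-graph $H$ with $\delta_d(H) \geq (1/2 - f(N)) \binom{N-d}{k-d}$ that does not contain the $k$-expansion of any $n$-vertex tree all of whose vertex degrees are odd.
   Context: A $k$-graph is a $k$-uniform hypergraph. For a $k$-graph $H$ and $S \subseteq V(H)$, $\deg_H(S)$ is the number of edges containing $S$, and $\delta_d(H)$ is the minimum of $\deg_H(S)$ over all $d$-subsets $S \subseteq V(H)$. The $k$-expansion $T^{(k)}$ of a graph $T$ is the $k$-graph obtained by replacing each edge $uv$ of $T$ by a $k$-edge consisting of $u$, $v$ and $k-2$ new vertices that belong to no other edge. "Contain" means as a (not necessarily induced) subgraph. -}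

module Defs where

open import Data.Fin.Base using (Fin; zero; suc)
open import Data.Fin.Properties using (any?; _≟_)
open import Data.Fin.Subset using (Subset; inside; outside; ⁅_⁆; _∪_; ∣_∣)
open import Data.Fin.Subset.Properties using (_∈?_; _⊆?_; ∣⊥∣≡0; ∣⁅x⁆∣≡1)
open import Data.List.Base as List using (List; []; _∷_; _∷ʳ_; length; filter)
open import Data.List.Extrema.Nat using (min)
open import Data.List.Membership.Propositional using (_∈_)
open import Data.List.Membership.Propositional.Properties using (∈-lookup)
open import Data.List.Relation.Unary.All as All using (All)
open import Data.List.Relation.Unary.All.Properties as All using ()
open import Data.List.Relation.Unary.AllPairs using (_∷_)
open import Data.List.Relation.Unary.Linked using (Linked)
open import Data.List.Relation.Unary.Unique.Propositional using (Unique)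
open import Data.List.Relation.Unary.Unique.Propositional.Properties as Unique using ()
open import Data.Nat.Base using (ℕ; zero; suc; _+_; _*_; _∸_; _≤_)
open import Data.Nat.Divisibility using (_∣_)
import Data.Nat.Properties as ℕ
open import Data.Product.Base using (Σ-syntax; ∃-syntax; _×_; _,_)
open import Data.Rational.Base as ℚ using (ℚ; 0ℚ)
open import Data.Vec.Base as Vec using ([]; _∷_; _++_; concat; replicate; tabulate)
open import Data.Vec.Properties using (++-injectiveˡ)
open import Function.Definitions using (Injective)
open import Relation.Binary.Construct.Closure.ReflexiveTransitive using (Star)
open import Relation.Binary.PropositionalEquality
  using (_≡_; refl; sym; trans; cong; cong₂; module ≡-Reasoning)
open import Relation.Nullary.Decidable using (does; _×-dec_)
open import Relation.Nullary.Negation using (¬_; contradiction)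

private
  variable
    k m n : ℕ

-- The edge set is a duplicate-free list, whose order is immaterial.
record KGraph (k n : ℕ) : Set where
  field
    edges   : List (Subset n)
    unique  : Unique edges
    uniform : All (λ e → ∣ e ∣ ≡ k) edges

open KGraph public

deg : KGraph k n → Subset n → ℕ
deg H S = length (filter (S ⊆?_) (edges H))

allSubsets : ∀ n → List (Subset n)
allSubsets zero    = [] ∷ []
allSubsets (suc n) =
  List.map (inside ∷_) (allSubsets n) List.++ List.map (outside ∷_) (allSubsets n)

subsetsOfSize : ℕ → ∀ n → List (Subset n)
subsetsOfSize d n = filter (λ S → ∣ S ∣ ℕ.≟ d) (allSubsets n)

-- The default value passed to min, the number of edges, bounds every degree
-- from above, so it matters only when there is no d-subset at all (d > n).
δ : ℕ → KGraph k n → ℕ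
δ {n = n} d H = min (length (edges H)) (List.map (deg H) (subsetsOfSize d n))

image : (Fin m → Fin n) → Subset m → Subset n
image φ S = tabulate λ y → does (any? λ x → (x ∈? S) ×-dec (φ x ≟ y))

Contains : KGraph k n → KGraph k m → Set
Contains {n = n} {m = m} H F =
  Σ[ φ ∈ (Fin m → Fin n) ]
    (Injective _≡_ _≡_ φ × (∀ e → e ∈ edges F → image φ e ∈ edges H))

Graph : ℕ → Set
Graph = KGraph 2

-- No vertex is adjacent to itself, since ⁅ v ⁆ ∪ ⁅ v ⁆ does not have size 2.
Adjacent : Graph n → Fin n → Fin n → Set
Adjacent G u v = (⁅ u ⁆ ∪ ⁅ v ⁆) ∈ edges G

Connected : Graph n → Set
Connected G = ∀ u v → Star (Adjacent G) u v

-- The cycle v, v₁, …, vₗ, v is given by the list v ∷ v₁ ∷ … ∷ vₗ of its vertices.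
IsCycle : Graph n → Fin n → List (Fin n) → Set
IsCycle G v vs =
  3 ≤ length (v ∷ vs) × Unique (v ∷ vs) × Linked (Adjacent G) ((v ∷ vs) ∷ʳ v)

record IsTree {n : ℕ} (G : Graph n) : Set where
  field
    nonempty  : 1 ≤ n
    connected : Connected G
    acyclic   : ∀ v vs → ¬ IsCycle G v vs

AllDegreesOdd : Graph n → Set
AllDegreesOdd G = ∀ v → ¬ (2 ∣ deg G ⁅ v ⁆)

private
  ∣++∣ : (p : Subset m) (q : Subset n) → ∣ p ++ q ∣ ≡ ∣ p ∣ + ∣ q ∣
  ∣++∣ []            q = refl
  ∣++∣ (inside  ∷ p) q = cong suc (∣++∣ p q)
  ∣++∣ (outside ∷ p) q = ∣++∣ p q

  ∣inside∣ : ∀ r → ∣ replicate r inside ∣ ≡ r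
  ∣inside∣ zero    = refl
  ∣inside∣ (suc r) = cong suc (∣inside∣ r)

  ∣outside∣ : ∀ r → ∣ replicate r outside ∣ ≡ 0
  ∣outside∣ = ∣⊥∣≡0

  lookup-injective : ∀ {a} {A : Set a} {xs : List A} → Unique xs →
                     ∀ {i j} → List.lookup xs i ≡ List.lookup xs j → i ≡ j
  lookup-injective {xs = x ∷ xs} (x∉ ∷ u) {zero}  {zero}  eq = refl
  lookup-injective {xs = x ∷ xs} (x∉ ∷ u) {zero}  {suc j} eq =
    contradiction eq (All.lookup x∉ (∈-lookup j))
  lookup-injective {xs = x ∷ xs} (x∉ ∷ u) {suc i} {zero}  eq =
    contradiction (sym eq) (All.lookup x∉ (∈-lookup i))
  lookup-injective {xs = x ∷ xs} (x∉ ∷ u) {suc i} {suc j} eq =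
    cong suc (lookup-injective u eq)

-- Each element of Fin m is blown up to r consecutive elements of Fin (m * r).
blowUp : ∀ r → Subset m → Subset (m * r)
blowUp r S = concat (Vec.map (replicate r) S)

∣blowUp∣ : ∀ r (S : Subset m) → ∣ blowUp r S ∣ ≡ ∣ S ∣ * r
∣blowUp∣ r []            = refl
∣blowUp∣ r (inside  ∷ S) =
  trans (∣++∣ (replicate r inside) (blowUp r S)) (cong₂ _+_ (∣inside∣ r) (∣blowUp∣ r S))
∣blowUp∣ r (outside ∷ S) =
  trans (∣++∣ (replicate r outside) (blowUp r S)) (cong₂ _+_ (∣outside∣ r) (∣blowUp∣ r S))

-- The first n vertices are those of T; the remaining ones form one block of
-- k - 2 vertices for each edge of T, and the i-th edge receives the i-th block.
expansionEdge : ∀ k (T : Graph n) → Fin (length (edges T)) →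
                Subset (n + length (edges T) * (k ∸ 2))
expansionEdge k T i = List.lookup (edges T) i ++ blowUp (k ∸ 2) ⁅ i ⁆

expansion : 2 ≤ k → (T : Graph n) → KGraph k (n + length (edges T) * (k ∸ 2))
expansion {k = k} 2≤k T = record
  { edges   = List.tabulate (expansionEdge k T)
  ; unique  = Unique.tabulate⁺ λ {i} {j} eq →
      lookup-injective (unique T)
        (++-injectiveˡ (List.lookup (edges T) i) (List.lookup (edges T) j) eq)
  ; uniform = All.tabulate⁺ size
  }
  where
  open ≡-Reasoning
  size : ∀ i → ∣ expansionEdge k T i ∣ ≡ k
  size i = begin
    ∣ expansionEdge k T i ∣
      ≡⟨ ∣++∣ (List.lookup (edges T) i) (blowUp (k ∸ 2) ⁅ i ⁆) ⟩
    ∣ List.lookup (edges T) i ∣ + ∣ blowUp (k ∸ 2) ⁅ i ⁆ ∣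
      ≡⟨ cong₂ _+_ (All.lookup (uniform T) (∈-lookup i)) (∣blowUp∣ (k ∸ 2) ⁅ i ⁆) ⟩
    2 + ∣ ⁅ i ⁆ ∣ * (k ∸ 2)
      ≡⟨ cong (λ s → 2 + s * (k ∸ 2)) (∣⁅x⁆∣≡1 i) ⟩
    2 + 1 * (k ∸ 2)
      ≡⟨ cong (2 +_) (ℕ.*-identityˡ (k ∸ 2)) ⟩
    2 + (k ∸ 2)
      ≡⟨ ℕ.m+[n∸m]≡n 2≤k ⟩
    k ∎

-- A rational sequence suffices to express a vanishing error term: every real null
-- sequence is bounded above by a rational one, and enlarging the error is harmless.
TendsToZero : (ℕ → ℚ) → Set
TendsToZero f =
  ∀ ε → 0ℚ ℚ.< ε → ∃[ N₀ ] (∀ N → N₀ ≤ N → ℚ.∣ f N ∣ ℚ.< ε)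

-- The order n + (n - 1)(k - 2) of the k-expansion of an n-vertex tree, in the form
-- (k - 1)n - k + 2; for n ≥ 1 and k ≥ 1 the subtraction does not truncate.
spanningOrder : ℕ → ℕ → ℕ
spanningOrder k n = (k ∸ 1) * n + 2 ∸ k

{-# OPTIONS --safe #-}
module Submission where

-- Fix a set A consisting of every other vertex, and let H consist of the k-sets e for
-- which |e ∩ A| has the parity opposite to that of |A|.  An expansion of an n-vertex
-- tree has as many vertices as H, so an embedding of it is spanning.  If all degrees of
-- the tree are odd, then so are those of the expansion, and summing |e ∩ A| over its
-- edges counts every vertex of A an odd number of times: the sum is congruent to |A|
-- modulo 2.  But it is a sum of n - 1 terms, an odd number, each congruent to |A| + 1.
--
-- For the codegrees, fix a d-set S and pair each vertex of A with the next one.  Among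
-- the extensions of S, those that contain exactly one vertex of a pair disjoint from S
-- cancel between the two parities.  Hence the numbers of even and of odd extensions
-- differ by at most 2^(d+1) C(N-d, k-d-1), which is O(1/N) times C(N-d, k-d).

open import Algebra.Bundles using (module CommutativeRing)
open import Data.Bool.Base using (Bool; true; false; not; _∧_; _xor_; if_then_else_)
open import Data.Bool.Properties using (not-involutive; not-¬; ∧-zeroʳ; xor-∧-commutativeRing)
import Data.Bool.Properties as Bool
import Data.Empty as Empty
open import Data.Fin.Base using (Fin; zero; suc; punchOut; splitAt; combine)
open import Data.Fin.Permutation using (Permutation; permutation)
open import Data.Fin.Properties using (any?; injective⇒≤; punchOut-injective; combine-surjective)
import Data.Fin.Properties as Fin
open import Data.Fin.Subset using (Subset; inside; outside; ∣_∣; ∁; ⁅_⁆; _∩_; _∪_; ⊥)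
import Data.Fin.Subset as Subset
import Data.Fin.Subset.Properties as Subset
open import Data.Fin.Subset.Properties
  using ( _⊆?_; p⊆q⇒∣p∣≤∣q∣; ∣⊥∣≡0; ∣⁅x⁆∣≡1; ∣∁p∣≡n∸∣p∣; x∈⁅x⁆; x∈⁅y⁆⇒x≡y
        ; ∪-comm; ∪-idem; ∪-identityˡ; x∈p∪q⁻; x∈p∪q⁺ )
open import Data.Integer.Base as ℤ using (+_)
import Data.Integer.Properties as ℤ
import Data.Integer.Tactic.RingSolver as ℤSolver
open import Data.List.Base as List using (List; []; _∷_; _∷ʳ_; length; filter)
open import Data.List.Extrema.Nat using (argmin-sel)
import Data.List.Membership.DecPropositional as DecMembership
open import Data.List.Membership.Propositional using (_∈_; _∉_)
open import Data.List.Membership.Propositional.Properties using (∈-map⁻; ∈-filter⁻; ∈-tabulate⁺)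
open import Data.List.Properties using (length-++; filter-++; length-filter)
open import Data.List.Relation.Unary.All as All using (All; []; _∷_)
open import Data.List.Relation.Unary.All.Properties using (all-filter; ¬Any⇒All¬; All¬⇒¬Any)
open import Data.List.Relation.Unary.AllPairs using ([]; _∷_)
open import Data.List.Relation.Unary.Any using (here; there)
open import Data.List.Relation.Unary.Linked as Linked using (Linked; [-]; _∷_)
open import Data.List.Relation.Unary.Unique.Propositional using (Unique)
import Data.List.Relation.Unary.Unique.Propositional.Properties as Unique
open import Data.Nat.Base hiding (parity; _/_)
open import Data.Nat.Combinatorics using (_C_; nC1≡n; nCk+nC[k+1]≡[n+1]C[k+1]; k>n⇒nCk≡0)
open import Data.Nat.Divisibility using (_∣_; divides; divides-refl; ∣m+n∣m⇒∣n; ∣⇒≤)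
open import Data.Nat.Properties
open import Data.Nat.Tactic.RingSolver using (solve-∀)
open import Data.Product.Base using (Σ-syntax; ∃-syntax; _×_; _,_; proj₁; proj₂)
open import Data.Rational.Base as ℚ using (ℚ; ½; 0ℚ; mkℚ; _/_)
import Data.Rational.Properties as ℚ
open import Data.Rational.Unnormalised.Base as ℚᵘ using (mkℚᵘ; *≤*; *<*)
import Data.Rational.Unnormalised.Properties as ℚᵘ
open import Data.Sum.Base using (_⊎_; inj₁; inj₂; [_,_]′)
open import Data.Vec.Base as Vec using ([]; _∷_; lookup; replicate; concat)
open import Data.Vec.Properties
  using ( ∷-injectiveʳ; lookup∘tabulate; lookup⇒[]=; []=⇒lookup; lookup-zipWith; lookup-splitAt
        ; lookup-concat; lookup-map; lookup-replicate )
open import Function.Base using (_∘_; id)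
open import Function.Definitions using (Injective)
open import Level using (Level)
open import Relation.Binary.Construct.Closure.ReflexiveTransitive as Star using (Star; ε; _◅_; _◅◅_)
open import Relation.Binary.Core using (Rel)
open import Relation.Binary.Definitions using (DecidableEquality; Symmetric)
open import Relation.Binary.PropositionalEquality
open import Relation.Nullary.Decidable using (Dec; yes; no; does; _×-dec_; dec-true; dec-false)
open import Relation.Nullary.Negation using (¬_; contradiction)
open import Relation.Unary using (Pred; Decidable)
open import Defs

import Algebra.Properties.CommutativeMonoid.Sum +-0-commutativeMonoid as ∑
open ∑ using (sum)
import Algebra.Properties.Semiring.Sum (CommutativeRing.semiring xor-∧-commutativeRing) as ⊕
open ⊕ using () renaming (sum to ⨁)

private
  variable
    ℓ ℓ₁ ℓ₂ : Level
    X Y : Set ℓ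
    k m n : ℕ

-- Binomial coefficients

nCk≤[1+n]Ck : ∀ n k → n C k ≤ suc n C k
nCk≤[1+n]Ck n zero    = ≤-refl
nCk≤[1+n]Ck n (suc k) = begin
  n C suc k          ≤⟨ m≤n+m _ _ ⟩
  n C k + n C suc k  ≡⟨ nCk+nC[k+1]≡[n+1]C[k+1] n k ⟩
  suc n C suc k      ∎
  where open ≤-Reasoning

nCk≤[1+n]C[1+k] : ∀ n k → n C k ≤ suc n C suc k
nCk≤[1+n]C[1+k] n k = begin
  n C k              ≤⟨ m≤m+n _ _ ⟩
  n C k + n C suc k  ≡⟨ nCk+nC[k+1]≡[n+1]C[k+1] n k ⟩
  suc n C suc k      ∎
  where open ≤-Reasoning

-- The absorption identity, by induction on `n`: Pascal's rule splits the left side, and the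
-- induction hypotheses at `k` and `k + 1` recombine by Pascal's rule again.
[1+k]*[1+n]C[1+k]≡[1+n]*nCk : ∀ n k → suc k * (suc n C suc k) ≡ suc n * (n C k)
[1+k]*[1+n]C[1+k]≡[1+n]*nCk zero zero    = refl
[1+k]*[1+n]C[1+k]≡[1+n]*nCk zero (suc k)
  rewrite k>n⇒nCk≡0 {1} {suc (suc k)} (s≤s (s≤s z≤n)) | k>n⇒nCk≡0 {0} {suc k} (s≤s z≤n) =
  *-zeroʳ k
[1+k]*[1+n]C[1+k]≡[1+n]*nCk (suc n) zero = begin
  1 * (suc (suc n) C 1)  ≡⟨ *-identityˡ _ ⟩
  suc (suc n) C 1        ≡⟨ nC1≡n (suc (suc n)) ⟩
  suc (suc n)            ≡⟨ *-identityʳ _ ⟨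
  suc (suc n) * 1        ∎
  where open ≡-Reasoning
[1+k]*[1+n]C[1+k]≡[1+n]*nCk (suc n) (suc k) = begin
  suc (suc k) * (suc (suc n) C suc (suc k))
    ≡⟨ cong (suc (suc k) *_) (nCk+nC[k+1]≡[n+1]C[k+1] (suc n) (suc k)) ⟨
  suc (suc k) * (x + y)
    ≡⟨ lem k x y ⟩
  x + (suc k * x + suc (suc k) * y)
    ≡⟨ cong (_+_ x) (cong₂ _+_ ([1+k]*[1+n]C[1+k]≡[1+n]*nCk n k)
                              ([1+k]*[1+n]C[1+k]≡[1+n]*nCk n (suc k))) ⟩
  x + (suc n * (n C k) + suc n * (n C suc k))
    ≡⟨ cong (_+_ x) (*-distribˡ-+ (suc n) (n C k) (n C suc k)) ⟨
  x + suc n * (n C k + n C suc k)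
    ≡⟨ cong (λ z → x + suc n * z) (nCk+nC[k+1]≡[n+1]C[k+1] n k) ⟩
  suc (suc n) * x ∎
  where
  open ≡-Reasoning
  x = suc n C suc k
  y = suc n C suc (suc k)
  lem : ∀ k x y → suc (suc k) * (x + y) ≡ x + (suc k * x + suc (suc k) * y)
  lem = solve-∀

-- The ratio of consecutive binomial coefficients, with `n` written as `j + k` to avoid truncated
-- subtraction. It later makes an error of lower order comparable with the main term.
[1+k]*nC[1+k]≡[n-k]*nCk : ∀ j k → suc k * ((j + k) C suc k) ≡ j * ((j + k) C k)
[1+k]*nC[1+k]≡[n-k]*nCk j k = +-cancelˡ-≡ (suc k * x) _ _ (begin
  suc k * x + suc k * y    ≡⟨ *-distribˡ-+ (suc k) x y ⟨
  suc k * (x + y)          ≡⟨ cong (suc k *_) (nCk+nC[k+1]≡[n+1]C[k+1] (j + k) k) ⟩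
  suc k * (suc (j + k) C suc k) ≡⟨ [1+k]*[1+n]C[1+k]≡[1+n]*nCk (j + k) k ⟩
  suc (j + k) * x          ≡⟨ lem j k x ⟩
  suc k * x + j * x        ∎)
  where
  open ≡-Reasoning
  x = (j + k) C k
  y = (j + k) C suc k
  lem : ∀ j k x → suc (j + k) * x ≡ suc k * x + j * x
  lem = solve-∀

-- The factor 2 serves `r = 0`, where truncation makes both summands equal to 1; otherwise this is
-- Pascal's rule.
nC[r∸1]+nCr≤2*[1+n]Cr : ∀ n r → n C (r ∸ 1) + n C r ≤ 2 * (suc n C r)
nC[r∸1]+nCr≤2*[1+n]Cr n zero    = ≤-refl
nC[r∸1]+nCr≤2*[1+n]Cr n (suc j) = begin
  n C j + n C suc j    ≡⟨ nCk+nC[k+1]≡[n+1]C[k+1] n j ⟩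
  suc n C suc j        ≤⟨ m≤m+n _ _ ⟩
  2 * (suc n C suc j)  ∎
  where open ≤-Reasoning

nC[r∸1]+nC[1+r]≤[2+n]C[1+r] : ∀ n r → n C (r ∸ 1) + n C suc r ≤ suc (suc n) C suc r
nC[r∸1]+nC[1+r]≤[2+n]C[1+r] n zero = begin
  1 + n C 1          ≡⟨ cong suc (nC1≡n n) ⟩
  suc n              ≤⟨ n≤1+n _ ⟩
  suc (suc n)        ≡⟨ nC1≡n (suc (suc n)) ⟨
  suc (suc n) C 1    ∎
  where open ≤-Reasoning
nC[r∸1]+nC[1+r]≤[2+n]C[1+r] n (suc j) = begin
  n C j + n C suc (suc j)                  ≤⟨ +-mono-≤ (nCk≤[1+n]C[1+k] n j) (nCk≤[1+n]Ck n (suc (suc j))) ⟩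
  suc n C suc j + suc n C suc (suc j)      ≡⟨ nCk+nC[k+1]≡[n+1]C[k+1] (suc n) (suc j) ⟩
  suc (suc n) C suc (suc j)                ∎
  where open ≤-Reasoning

-- Parity of subsets and counts of supersets

-- The size modulo 2. Since `⨁` is summation in the two-element field, with `xor` as addition,
-- double counting modulo 2 becomes an exchange of finite sums.
parity : Subset n → Bool
parity S = ⨁ (lookup S)

-- Counting by recursion on the first coordinate, instead of filtering a list, matches the recursion
-- of `supersets`.
#_ : (Subset n → Bool) → ℕ
#_ {zero}  f = if f [] then 1 else 0
#_ {suc n} f = # (f ∘ (inside ∷_)) + # (f ∘ (outside ∷_))

#-cong : {f g : Subset n → Bool} → f ≗ g → # f ≡ # g
#-cong {zero}  f≗g = cong (if_then 1 else 0) (f≗g [])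
#-cong {suc n} f≗g = cong₂ _+_ (#-cong (f≗g ∘ (inside ∷_))) (#-cong (f≗g ∘ (outside ∷_)))

#-false : ∀ n → # (λ (_ : Subset n) → false) ≡ 0
#-false zero    = refl
#-false (suc n) = cong₂ _+_ (#-false n) (#-false n)

length-filter-filter : {P : Pred X ℓ₁} {Q : Pred X ℓ₂} (P? : Decidable P) (Q? : Decidable Q) →
  ∀ xs → length (filter P? (filter Q? xs)) ≡ length (filter (λ x → P? x ×-dec Q? x) xs)
length-filter-filter P? Q? [] = refl
length-filter-filter P? Q? (x ∷ xs) with does (Q? x)
... | false rewrite ∧-zeroʳ (does (P? x)) = length-filter-filter P? Q? xs
... | true  with does (P? x)
...   | true  = cong suc (length-filter-filter P? Q? xs)
...   | false = length-filter-filter P? Q? xs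

length-filter-map : {P : Pred Y ℓ₁} (P? : Decidable P) (f : X → Y) →
  ∀ xs → length (filter P? (List.map f xs)) ≡ length (filter (P? ∘ f) xs)
length-filter-map P? f [] = refl
length-filter-map P? f (x ∷ xs) with does (P? (f x))
... | true  = cong suc (length-filter-map P? f xs)
... | false = length-filter-map P? f xs

length-filter-allSubsets : {P : Pred (Subset n) ℓ₁} (P? : Decidable P) →
  length (filter P? (allSubsets n)) ≡ # (does ∘ P?)
length-filter-allSubsets {n = zero} P? with does (P? [])
... | true  = refl
... | false = refl
length-filter-allSubsets {n = suc n} P? = begin
  length (filter P? (List.map (inside ∷_) xs List.++ List.map (outside ∷_) xs))
    ≡⟨ cong length (filter-++ P? (List.map (inside ∷_) xs) _) ⟩
  length (filter P? (List.map (inside ∷_) xs) List.++ filter P? (List.map (outside ∷_) xs))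
    ≡⟨ length-++ (filter P? (List.map (inside ∷_) xs)) ⟩
  length (filter P? (List.map (inside ∷_) xs)) + length (filter P? (List.map (outside ∷_) xs))
    ≡⟨ cong₂ _+_ (half inside) (half outside) ⟩
  # (does ∘ P? ∘ (inside ∷_)) + # (does ∘ P? ∘ (outside ∷_)) ∎
  where
  open ≡-Reasoning
  xs = allSubsets n
  half : ∀ s → length (filter P? (List.map (s ∷_) xs)) ≡ # (does ∘ P? ∘ (s ∷_))
  half s = trans (length-filter-map P? (s ∷_) xs) (length-filter-allSubsets (P? ∘ (s ∷_)))

-- supersets S A r b is the number of the supersets of S with r further elements whose
-- intersection with A has parity b.
supersets : Subset n → Subset n → ℕ → Bool → ℕ
supersets []            []      zero    b = if b then 0 else 1
supersets []            []      (suc r) b = 0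
supersets (inside  ∷ S) (a ∷ A) r       b = supersets S A r (a xor b)
supersets (outside ∷ S) (a ∷ A) zero    b = supersets S A zero b
supersets (outside ∷ S) (a ∷ A) (suc r) b = supersets S A r (a xor b) + supersets S A (suc r) b

supersetOf? : (S A : Subset n) (k : ℕ) (b : Bool) (e : Subset n) → Dec _
supersetOf? S A k b e = (S ⊆? e) ×-dec ((∣ e ∣ ≟ k) ×-dec (parity (e ∩ A) Bool.≟ b))

xor-≟ : ∀ a p b → does ((a xor p) Bool.≟ b) ≡ does (p Bool.≟ (a xor b))
xor-≟ false p     b     = refl
xor-≟ true  false false = refl
xor-≟ true  false true  = refl
xor-≟ true  true  false = refl
xor-≟ true  true  true  = refl

#-supersetOf : (S A : Subset n) → ∀ r b →
  # (does ∘ supersetOf? S A (∣ S ∣ + r) b) ≡ supersets S A r b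
#-supersetOf []            []      zero    false = refl
#-supersetOf []            []      zero    true  = refl
#-supersetOf []            []      (suc r) b     = refl
#-supersetOf {suc n} (inside ∷ S) (a ∷ A) r b = begin
  # (does ∘ supersetOf? (inside ∷ S) (a ∷ A) (suc (∣ S ∣ + r)) b ∘ (inside ∷_)) +
  # (λ (_ : Subset n) → false)
    ≡⟨ cong₂ _+_ (#-cong λ e → cong (λ z → does (S ⊆? e) ∧ does (∣ e ∣ ≟ ∣ S ∣ + r) ∧ z)
                               (xor-≟ a (parity (e ∩ A)) b)) (#-false n) ⟩
  # (does ∘ supersetOf? S A (∣ S ∣ + r) (a xor b)) + 0
    ≡⟨ +-identityʳ _ ⟩
  # (does ∘ supersetOf? S A (∣ S ∣ + r) (a xor b))
    ≡⟨ #-supersetOf S A r (a xor b) ⟩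
  supersets S A r (a xor b) ∎
  where open ≡-Reasoning
#-supersetOf {suc n} (outside ∷ S) (a ∷ A) zero b = cong₂ _+_
  (trans (#-cong tooBig) (#-false n)) (#-supersetOf S A zero b)
  where
  tooBig : ∀ e → does (supersetOf? (outside ∷ S) (a ∷ A) (∣ S ∣ + 0) b (inside ∷ e)) ≡ false
  tooBig e with S ⊆? e
  ... | no  _   = refl
  ... | yes S⊆e = cong (_∧ does (parity ((inside ∷ e) ∩ (a ∷ A)) Bool.≟ b)) (dec-false (suc ∣ e ∣ ≟ ∣ S ∣ + 0)
    (>⇒≢ (subst (_< suc ∣ e ∣) (sym (+-identityʳ ∣ S ∣)) (s≤s (p⊆q⇒∣p∣≤∣q∣ S⊆e)))))
#-supersetOf (outside ∷ S) (a ∷ A) (suc r) b = cong₂ _+_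
  (trans (#-cong with∷) (#-supersetOf S A r (a xor b))) (#-supersetOf S A (suc r) b)
  where
  with∷ : ∀ e → does (supersetOf? (outside ∷ S) (a ∷ A) (∣ S ∣ + suc r) b (inside ∷ e)) ≡
                does (supersetOf? S A (∣ S ∣ + r) (a xor b) e)
  with∷ e rewrite +-suc (∣ S ∣) r = cong (λ z → does (S ⊆? e) ∧ does (∣ e ∣ ≟ ∣ S ∣ + r) ∧ z)
                               (xor-≟ a (parity (e ∩ A)) b)

supersets-total : (S A : Subset n) → ∀ r b →
  supersets S A r b + supersets S A r (not b) ≡ ∣ ∁ S ∣ C r
supersets-total []            []      zero    false = refl
supersets-total []            []      zero    true  = refl
supersets-total []            []      (suc r) b     = sym (k>n⇒nCk≡0 (s≤s (z≤n {r})))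
supersets-total (inside  ∷ S) (true  ∷ A) r   b     = supersets-total S A r (not b)
supersets-total (inside  ∷ S) (false ∷ A) r   b     = supersets-total S A r b
supersets-total (outside ∷ S) (a ∷ A) zero    b     = supersets-total S A zero b
supersets-total (outside ∷ S) (a ∷ A) (suc r) b     = begin
  (x + y) + (x′ + y′)    ≡⟨ lem x y x′ y′ ⟩
  (x + x′) + (y + y′)    ≡⟨ cong₂ _+_ (shift a) (supersets-total S A (suc r) b) ⟩
  ∣ ∁ S ∣ C r + ∣ ∁ S ∣ C suc r  ≡⟨ nCk+nC[k+1]≡[n+1]C[k+1] ∣ ∁ S ∣ r ⟩
  suc ∣ ∁ S ∣ C suc r    ∎
  where
  open ≡-Reasoning
  x  = supersets S A r (a xor b)
  x′ = supersets S A r (a xor not b)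
  y  = supersets S A (suc r) b
  y′ = supersets S A (suc r) (not b)
  lem : ∀ x y x′ y′ → (x + y) + (x′ + y′) ≡ (x + x′) + (y + y′)
  lem = solve-∀
  -- If the new element lies in `A`, taking it swaps the two parities, which leaves their sum
  -- unchanged.
  shift : ∀ a → supersets S A r (a xor b) + supersets S A r (a xor not b) ≡ ∣ ∁ S ∣ C r
  shift true  = supersets-total S A r (not b)
  shift false = supersets-total S A r b

-- Balance of the two parities for the alternating set

-- Recursion in steps of two makes each pair, one vertex in the set and one outside, a single step
-- of the inductions below. For odd `n` the last vertex is unpaired.
alternating : ∀ n → Subset n
alternating zero          = []
alternating (suc zero)    = outside ∷ []
alternating (suc (suc n)) = inside ∷ outside ∷ alternating n

+-mono-≤-+ : ∀ {u x c d} v y → u ≤ v + c → x ≤ y + d → u + x ≤ (v + y) + (c + d)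
+-mono-≤-+ {u} {x} {c} {d} v y u≤ x≤ = begin
  u + x              ≤⟨ +-mono-≤ u≤ x≤ ⟩
  (v + c) + (y + d)  ≡⟨ lem v c y d ⟩
  (v + y) + (c + d)  ∎
  where
  open ≤-Reasoning
  lem : ∀ v c y d → (v + c) + (y + d) ≡ (v + y) + (c + d)
  lem = solve-∀

-- The allowed difference between the two parities. Each vertex of `S` accounts for a factor 2; at
-- `r = 0` the truncation leaves the power of 2 alone.
discrepancy : Subset n → ℕ → ℕ
discrepancy S r = 2 ^ suc ∣ S ∣ * (∣ ∁ S ∣ C (r ∸ 1))

discrepancy-inside : (S : Subset n) → ∀ r → discrepancy S r ≤ discrepancy (inside ∷ S) r
discrepancy-inside S r = *-monoˡ-≤ (∣ ∁ S ∣ C (r ∸ 1)) (^-monoʳ-≤ 2 (n≤1+n (suc ∣ S ∣)))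

-- For a pair with one vertex in `S`: the other vertex is taken or not, whence the two summands, and
-- the additional vertex of `S` supplies the factor 2. Only sizes enter, so both orders of the pair
-- are covered.
discrepancy-single : (S : Subset n) → ∀ r →
  discrepancy S r + discrepancy S (suc r) ≤ discrepancy (inside ∷ outside ∷ S) (suc r)
discrepancy-single S r = begin
  p * (∣ ∁ S ∣ C (r ∸ 1)) + p * (∣ ∁ S ∣ C r)  ≡⟨ *-distribˡ-+ p _ _ ⟨
  p * (∣ ∁ S ∣ C (r ∸ 1) + ∣ ∁ S ∣ C r)        ≤⟨ *-monoʳ-≤ p (nC[r∸1]+nCr≤2*[1+n]Cr ∣ ∁ S ∣ r) ⟩
  p * (2 * (suc ∣ ∁ S ∣ C r))                  ≡⟨ lem p _ ⟩
  2 * p * (suc ∣ ∁ S ∣ C r)                    ∎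
  where
  open ≤-Reasoning
  p = 2 ^ suc ∣ S ∣
  lem : ∀ p x → p * (2 * x) ≡ 2 * p * x
  lem = solve-∀

-- For a pair disjoint from `S`: the summands belong to taking both of its vertices and to taking
-- neither.
discrepancy-pair : (S : Subset n) → ∀ r →
  discrepancy S r + discrepancy S (suc (suc r)) ≤ discrepancy (outside ∷ outside ∷ S) (suc (suc r))
discrepancy-pair S r = begin
  p * (∣ ∁ S ∣ C (r ∸ 1)) + p * (∣ ∁ S ∣ C suc r)  ≡⟨ *-distribˡ-+ p _ _ ⟨
  p * (∣ ∁ S ∣ C (r ∸ 1) + ∣ ∁ S ∣ C suc r)        ≤⟨ *-monoʳ-≤ p (nC[r∸1]+nC[1+r]≤[2+n]C[1+r] ∣ ∁ S ∣ r) ⟩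
  p * (suc (suc ∣ ∁ S ∣) C suc r)                  ∎
  where
  open ≤-Reasoning
  p = 2 ^ suc ∣ S ∣

-- Induction over the pairs. A pair inside `S` only flips the required parity. A pair with one
-- vertex in `S` leaves the other vertex free, and the errors of the two choices add up. A disjoint
-- pair yields an error only when both or none of its vertices are taken.
supersets-balanced : (S : Subset n) → ∀ r b →
  supersets S (alternating n) r b ≤ supersets S (alternating n) r (not b) + discrepancy S r
supersets-balanced {zero}  [] zero    false = s≤s z≤n
supersets-balanced {zero}  [] zero    true  = z≤n
supersets-balanced {zero}  [] (suc r) b     = z≤n
supersets-balanced {suc zero} (inside ∷ []) zero    false = s≤s z≤n
supersets-balanced {suc zero} (inside ∷ []) zero    true  = z≤n
supersets-balanced {suc zero} (inside ∷ []) (suc r) b     = z≤n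
supersets-balanced {suc zero} (outside ∷ []) zero   false = s≤s z≤n
supersets-balanced {suc zero} (outside ∷ []) zero   true  = z≤n
supersets-balanced {suc zero} (outside ∷ []) (suc zero) false = s≤s z≤n
supersets-balanced {suc zero} (outside ∷ []) (suc zero) true  = z≤n
supersets-balanced {suc zero} (outside ∷ []) (suc (suc r)) b  = z≤n
supersets-balanced {suc (suc n)} (inside ∷ inside ∷ S) r b = begin
  supersets S A r (not b)
    ≤⟨ supersets-balanced S r (not b) ⟩
  supersets S A r (not (not b)) + discrepancy S r
    ≤⟨ +-monoʳ-≤ _ (≤-trans (discrepancy-inside S r) (discrepancy-inside (inside ∷ S) r)) ⟩
  supersets S A r (not (not b)) + discrepancy (inside ∷ inside ∷ S) r  ∎
  where
  open ≤-Reasoning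
  A = alternating n
supersets-balanced {suc (suc n)} (inside ∷ outside ∷ S) zero b = begin
  supersets S A 0 (not b)
    ≤⟨ supersets-balanced S 0 (not b) ⟩
  supersets S A 0 (not (not b)) + discrepancy S 0
    ≤⟨ +-monoʳ-≤ (supersets S A 0 (not (not b))) (discrepancy-inside S 0) ⟩
  supersets S A 0 (not (not b)) + discrepancy (inside ∷ outside ∷ S) 0  ∎
  where
  open ≤-Reasoning
  A = alternating n
supersets-balanced {suc (suc n)} (inside ∷ outside ∷ S) (suc r) b = begin
  supersets S A r (not b) + supersets S A (suc r) (not b)
    ≤⟨ +-mono-≤-+ (supersets S A r (not (not b))) (supersets S A (suc r) (not (not b)))
         (supersets-balanced S r (not b)) (supersets-balanced S (suc r) (not b)) ⟩
  supersets S A r (not (not b)) + supersets S A (suc r) (not (not b)) +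
    (discrepancy S r + discrepancy S (suc r))
    ≤⟨ +-monoʳ-≤ _ (discrepancy-single S r) ⟩
  supersets S A r (not (not b)) + supersets S A (suc r) (not (not b)) +
    discrepancy (inside ∷ outside ∷ S) (suc r)  ∎
  where
  open ≤-Reasoning
  A = alternating n
supersets-balanced {suc (suc n)} (outside ∷ inside ∷ S) zero b = begin
  supersets S A 0 b
    ≤⟨ supersets-balanced S 0 b ⟩
  supersets S A 0 (not b) + discrepancy S 0
    ≤⟨ +-monoʳ-≤ (supersets S A 0 (not b)) (discrepancy-inside S 0) ⟩
  supersets S A 0 (not b) + discrepancy (outside ∷ inside ∷ S) 0  ∎
  where
  open ≤-Reasoning
  A = alternating n
supersets-balanced {suc (suc n)} (outside ∷ inside ∷ S) (suc r) b = begin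
  supersets S A r (not b) + supersets S A (suc r) b
    ≤⟨ +-mono-≤-+ (supersets S A r (not (not b))) (supersets S A (suc r) (not b))
         (supersets-balanced S r (not b)) (supersets-balanced S (suc r) b) ⟩
  supersets S A r (not (not b)) + supersets S A (suc r) (not b) +
    (discrepancy S r + discrepancy S (suc r))
    ≤⟨ +-monoʳ-≤ _ (discrepancy-single S r) ⟩
  supersets S A r (not (not b)) + supersets S A (suc r) (not b) +
    discrepancy (outside ∷ inside ∷ S) (suc r)  ∎
  where
  open ≤-Reasoning
  A = alternating n
supersets-balanced {suc (suc n)} (outside ∷ outside ∷ S) zero b = supersets-balanced S 0 b
-- With one further element, both vertices of the pair cannot be taken, so only the choice of
-- neither uses the induction hypothesis; its error involves `n C 0`, which the pair does not
-- change.
supersets-balanced {suc (suc n)} (outside ∷ outside ∷ S) (suc zero) b = begin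
  f 0 (not b) + (f 0 b + f 1 b)
    ≡⟨ lem (f 0 (not b)) (f 0 b) (f 1 b) ⟩
  (f 0 b + f 0 (not b)) + f 1 b
    ≤⟨ +-monoʳ-≤ _ (supersets-balanced S 1 b) ⟩
  (f 0 b + f 0 (not b)) + (f 1 (not b) + discrepancy S 1)
    ≡⟨ +-assoc (f 0 b) _ _ ⟩
  f 0 b + (f 0 (not b) + (f 1 (not b) + discrepancy S 1))
    ≡⟨ cong (_+_ (f 0 b)) (+-assoc (f 0 (not b)) _ _) ⟨
  f 0 b + ((f 0 (not b) + f 1 (not b)) + discrepancy S 1)
    ≡⟨ +-assoc (f 0 b) _ _ ⟨
  f 0 b + (f 0 (not b) + f 1 (not b)) + discrepancy S 1
    ≡⟨ cong (λ b′ → f 0 b′ + (f 0 (not b) + f 1 (not b)) + discrepancy S 1) (not-involutive b) ⟨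
  f 0 (not (not b)) + (f 0 (not b) + f 1 (not b)) + discrepancy S 1 ∎
  where
  open ≤-Reasoning
  f = supersets S (alternating n)
  lem : ∀ x y z → x + (y + z) ≡ (y + x) + z
  lem = solve-∀
-- Of the four intersections with the pair, the two of size one cancel.
supersets-balanced {suc (suc n)} (outside ∷ outside ∷ S) (suc (suc r)) b = begin
  (f r (not b) + f (suc r) (not b)) + (f (suc r) b + f (suc (suc r)) b)
    ≡⟨ regroup (f r (not b)) (f (suc r) (not b)) (f (suc r) b) (f (suc (suc r)) b) ⟩
  (f (suc r) b + f (suc r) (not b)) + (f r (not b) + f (suc (suc r)) b)
    ≤⟨ +-monoʳ-≤ (f (suc r) b + f (suc r) (not b))
         (+-mono-≤-+ (f r (not (not b))) (f (suc (suc r)) (not b))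
           (supersets-balanced S r (not b)) (supersets-balanced S (suc (suc r)) b)) ⟩
  (f (suc r) b + f (suc r) (not b)) +
    ((f r (not (not b)) + f (suc (suc r)) (not b)) + (discrepancy S r + discrepancy S (suc (suc r))))
    ≤⟨ +-monoʳ-≤ (f (suc r) b + f (suc r) (not b)) (+-monoʳ-≤ _ (discrepancy-pair S r)) ⟩
  (f (suc r) b + f (suc r) (not b)) +
    ((f r (not (not b)) + f (suc (suc r)) (not b)) + D)
    ≡⟨ ungroup (f (suc r) b) (f (suc r) (not b)) (f r (not (not b))) (f (suc (suc r)) (not b)) D ⟩
  (f r (not (not b)) + f (suc r) b) + (f (suc r) (not b) + f (suc (suc r)) (not b)) + D
    ≡⟨ cong (λ b′ → (f r (not (not b)) + f (suc r) b′) + (f (suc r) (not b) + f (suc (suc r)) (not b)) + D)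
            (not-involutive b) ⟨
  (f r (not (not b)) + f (suc r) (not (not b))) + (f (suc r) (not b) + f (suc (suc r)) (not b)) + D ∎
  where
  open ≤-Reasoning
  f = supersets S (alternating n)
  D = discrepancy (outside ∷ outside ∷ S) (suc (suc r))
  regroup : ∀ w x y z → (w + x) + (y + z) ≡ (y + x) + (w + z)
  regroup = solve-∀
  ungroup : ∀ x y w z d → (x + y) + ((w + z) + d) ≡ (w + x) + (y + z) + d
  ungroup = solve-∀

-- The parity hypergraph and its codegrees

parityEdge? : ∀ k (A : Subset n) b (e : Subset n) → Dec (∣ e ∣ ≡ k × parity (e ∩ A) ≡ b)
parityEdge? k A b e = (∣ e ∣ ≟ k) ×-dec (parity (e ∩ A) Bool.≟ b)

allSubsets-unique : ∀ n → Unique (allSubsets n)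
allSubsets-unique zero    = [] ∷ []
allSubsets-unique (suc n) = Unique.++⁺
  (Unique.map⁺ ∷-injectiveʳ (allSubsets-unique n))
  (Unique.map⁺ ∷-injectiveʳ (allSubsets-unique n))
  λ (in∈ , out∈) → heads (∈-map⁻ (inside ∷_) in∈) (∈-map⁻ (outside ∷_) out∈)
  where
  heads : ∀ {e : Subset (suc n)} → (∃[ p ] p ∈ allSubsets n × e ≡ inside ∷ p) →
          (∃[ p ] p ∈ allSubsets n × e ≡ outside ∷ p) → Empty.⊥
  heads (_ , _ , refl) (_ , _ , ())

parityGraph : ∀ k → Subset n → Bool → KGraph k n
parityGraph {n} k A b = record
  { edges   = filter (parityEdge? k A b) (allSubsets n)
  ; unique  = Unique.filter⁺ (parityEdge? k A b) (allSubsets-unique n)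
  ; uniform = All.map proj₁ (all-filter (parityEdge? k A b) (allSubsets n))
  }

deg-parityGraph : ∀ {d} (A S : Subset n) → ∣ S ∣ ≡ d → ∀ r b →
  deg (parityGraph (d + r) A b) S ≡ supersets S A r b
deg-parityGraph {n} A S refl r b = begin
  deg (parityGraph (∣ S ∣ + r) A b) S
    ≡⟨ length-filter-filter (S ⊆?_) (parityEdge? (∣ S ∣ + r) A b) (allSubsets n) ⟩
  length (filter (supersetOf? S A (∣ S ∣ + r) b) (allSubsets n))
    ≡⟨ length-filter-allSubsets (supersetOf? S A (∣ S ∣ + r) b) ⟩
  # (does ∘ supersetOf? S A (∣ S ∣ + r) b)
    ≡⟨ #-supersetOf S A r b ⟩
  supersets S A r b ∎
  where open ≡-Reasoning

∃-subset-of-size : ∀ {d n} → d ≤ n → ∃[ S ] ∣_∣ {n} S ≡ d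
∃-subset-of-size {n = n} z≤n = ⊥ , ∣⊥∣≡0 n
∃-subset-of-size (s≤s d≤n) with S , ∣S∣≡d ← ∃-subset-of-size d≤n = inside ∷ S , cong suc ∣S∣≡d

-- The minimum is attained at the degree of a `d`-set or at the default value, the number of edges.
-- The latter is at least the degree of some `d`-set, which exists as `d ≤ n`, so upward closure of
-- `P` settles it.
δ-elim : ∀ {d} (P : ℕ → Set) → d ≤ n → (∀ {x y} → x ≤ y → P x → P y) →
         (H : KGraph k n) → (∀ S → ∣ S ∣ ≡ d → P (deg H S)) → P (δ d H)
δ-elim {n = n} {d = d} P d≤n up H Pdeg
  with argmin-sel id (length (edges H)) (List.map (deg H) (subsetsOfSize d n))
... | inj₁ eq = subst P (sym eq) (let S , ∣S∣≡d = ∃-subset-of-size d≤n in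
                  up (length-filter (S ⊆?_) (edges H)) (Pdeg S ∣S∣≡d))
... | inj₂ ∈map with S , S∈ , eq ← ∈-map⁻ (deg H) ∈map =
  subst P (sym eq) (Pdeg S (proj₂ (∈-filter⁻ (λ S → ∣ S ∣ ≟ d) {xs = allSubsets n} S∈)))

-- The two parities add up to the binomial coefficient, and the other parity exceeds `b` by at most
-- the discrepancy.
supersets-bound : ∀ {d} (S : Subset n) → ∣ S ∣ ≡ d → ∣ ∁ S ∣ ≡ m → ∀ j b →
  m C suc j ≤ 2 * supersets S (alternating n) (suc j) b + 2 ^ suc d * (m C j)
supersets-bound {n} S refl refl j b = begin
  ∣ ∁ S ∣ C suc j      ≡⟨ supersets-total S (alternating n) (suc j) b ⟨
  x + y                ≤⟨ +-monoʳ-≤ x (supersets-balanced S (suc j) (not b)) ⟩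
  x + (supersets S (alternating n) (suc j) (not (not b)) + e)
                       ≡⟨ cong (λ b′ → x + (supersets S (alternating n) (suc j) b′ + e)) (not-involutive b) ⟩
  x + (x + e)          ≡⟨ lem x e ⟩
  2 * x + e            ∎
  where
  open ≤-Reasoning
  x = supersets S (alternating n) (suc j) b
  y = supersets S (alternating n) (suc j) (not b)
  e = discrepancy S (suc j)
  lem : ∀ x e → x + (x + e) ≡ 2 * x + e
  lem = solve-∀

-- Here `k = d + suc j` and `i = N - k`. Multiplication by `suc i` turns the error term
-- `(N ∸ d) C j` into `suc j` times `M`, so the error relative to `M` is `2 ^ d * (k - d)` over
-- `N - k + 1`.
δ-bound : ∀ d j i b → let N = i + (d + suc j); M = (N ∸ d) C suc j in
  suc i * M ≤ 2 * (suc i * δ d (parityGraph (d + suc j) (alternating N) b)) + 2 * ((2 ^ d * suc j) * M)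
δ-bound d j i b = δ-elim P d≤N up H degs
  where
  N = i + (d + suc j)
  M = (N ∸ d) C suc j
  H = parityGraph (d + suc j) (alternating N) b
  d≤N : d ≤ N
  d≤N = ≤-trans (m≤m+n d (suc j)) (m≤n+m _ i)
  P : ℕ → Set
  P x = suc i * M ≤ 2 * (suc i * x) + 2 * ((2 ^ d * suc j) * M)
  up : ∀ {x y} → x ≤ y → P x → P y
  up x≤y Px = ≤-trans Px (+-monoˡ-≤ _ (*-monoʳ-≤ 2 (*-monoʳ-≤ (suc i) x≤y)))
  ∸-eq : N ∸ d ≡ suc i + j
  ∸-eq = begin
    i + (d + suc j) ∸ d  ≡⟨ cong (_∸ d) (lem i d j) ⟩
    d + (suc i + j) ∸ d  ≡⟨ m+n∸m≡n d (suc i + j) ⟩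
    suc i + j            ∎
    where
    open ≡-Reasoning
    lem : ∀ i d j → i + (d + suc j) ≡ d + (suc i + j)
    lem = solve-∀
  degs : ∀ S → ∣ S ∣ ≡ d → P (deg H S)
  degs S ∣S∣≡d = begin
    suc i * M                                  ≡⟨ cong (λ m → suc i * (m C suc j)) ∸-eq ⟩
    suc i * ((suc i + j) C suc j)
      ≤⟨ *-monoʳ-≤ (suc i) (supersets-bound S ∣S∣≡d (trans ∣∁S∣≡ ∸-eq) j b) ⟩
    suc i * (2 * s + 2 ^ suc d * ((suc i + j) C j))  ≡⟨ lem₁ (suc i) s (2 ^ d) _ ⟩
    2 * (suc i * s) + 2 ^ suc d * (suc i * ((suc i + j) C j))
      ≡⟨ cong (λ z → 2 * (suc i * s) + 2 ^ suc d * z) ([1+k]*nC[1+k]≡[n-k]*nCk (suc i) j) ⟨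
    2 * (suc i * s) + 2 ^ suc d * (suc j * ((suc i + j) C suc j))
      ≡⟨ lem₂ (2 * (suc i * s)) (2 ^ d) (suc j) _ ⟩
    2 * (suc i * s) + 2 * ((2 ^ d * suc j) * ((suc i + j) C suc j))
      ≡⟨ cong₂ (λ x m → 2 * (suc i * x) + 2 * ((2 ^ d * suc j) * (m C suc j)))
           (deg-parityGraph (alternating N) S ∣S∣≡d (suc j) b) ∸-eq ⟨
    2 * (suc i * deg H S) + 2 * ((2 ^ d * suc j) * M) ∎
    where
    open ≤-Reasoning
    s = supersets S (alternating N) (suc j) b
    ∣∁S∣≡ = trans (∣∁p∣≡n∸∣p∣ S) (cong (N ∸_) ∣S∣≡d)
    lem₁ : ∀ i s p c → i * (2 * s + 2 * p * c) ≡ 2 * (i * s) + 2 * p * (i * c)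
    lem₁ = solve-∀
    lem₂ : ∀ x p j c → x + 2 * p * (j * c) ≡ x + 2 * ((p * j) * c)
    lem₂ = solve-∀

-- The bound in rational numbers and the vanishing error

-- The exact form that the inequality between unnormalised fractions in `½-x-bound` unfolds to. It
-- is stated over the integers because `½` minus the error may be negative.
cross-multiplied : ∀ c i M D → suc i * M ≤ 2 * (suc i * D) + 2 * (c * M) →
  ((+ 1 ℤ.* + suc i ℤ.+ (ℤ.- + c) ℤ.* + 2) ℤ.* + M) ℤ.* + 1 ℤ.≤ + D ℤ.* + (2 * suc i * 1)
cross-multiplied c i M D h = begin
  ((+ 1 ℤ.* + suc i ℤ.+ (ℤ.- + c) ℤ.* + 2) ℤ.* + M) ℤ.* + 1
    ≡⟨ expand (+ suc i) (+ c) (+ M) ⟩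
  + suc i ℤ.* + M ℤ.- + 2 ℤ.* (+ c ℤ.* + M)
    ≡⟨ cong₂ ℤ._-_ (ℤ.pos-* (suc i) M)
         (trans (ℤ.pos-* 2 (c * M)) (cong (+ 2 ℤ.*_) (ℤ.pos-* c M))) ⟨
  + (suc i * M) ℤ.- E
    ≤⟨ ℤ.+-monoˡ-≤ (ℤ.- E) (ℤ.+≤+ h) ⟩
  + (2 * (suc i * D) + 2 * (c * M)) ℤ.- E
    ≡⟨ cong (ℤ._- E) (ℤ.pos-+ (2 * (suc i * D)) (2 * (c * M))) ⟩
  + (2 * (suc i * D)) ℤ.+ E ℤ.- E
    ≡⟨ cancel (+ (2 * (suc i * D))) E ⟩
  + (2 * (suc i * D))
    ≡⟨ cong +_ (rearrange (suc i) D) ⟩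
  + (D * (2 * suc i * 1))
    ≡⟨ ℤ.pos-* D (2 * suc i * 1) ⟩
  + D ℤ.* + (2 * suc i * 1) ∎
  where
  open ℤ.≤-Reasoning
  E = + (2 * (c * M))
  expand : ∀ i c M → ((+ 1 ℤ.* i ℤ.+ (ℤ.- c) ℤ.* + 2) ℤ.* M) ℤ.* + 1 ≡ i ℤ.* M ℤ.- + 2 ℤ.* (c ℤ.* M)
  expand = ℤSolver.solve-∀
  cancel : ∀ x y → x ℤ.+ y ℤ.- y ≡ x
  cancel = ℤSolver.solve-∀
  rearrange : ∀ i D → 2 * (i * D) ≡ D * (2 * i * 1)
  rearrange = solve-∀

½-x-bound : ∀ c i M D → suc i * M ≤ 2 * (suc i * D) + 2 * (c * M) →
  (½ ℚ.- (+ c / suc i)) ℚ.* (+ M / 1) ℚ.≤ (+ D / 1)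
½-x-bound c i M D h = ℚ.toℚᵘ-cancel-≤ (begin
  ℚ.toℚᵘ ((½ ℚ.- (+ c / suc i)) ℚ.* (+ M / 1))
    ≃⟨ ℚ.toℚᵘ-homo-* (½ ℚ.- (+ c / suc i)) (+ M / 1) ⟩
  ℚ.toℚᵘ (½ ℚ.- (+ c / suc i)) ℚᵘ.* ℚ.toℚᵘ (+ M / 1)
    ≃⟨ ℚᵘ.*-cong
         (ℚᵘ.≃-trans (ℚ.toℚᵘ-homo-+ ½ (ℚ.- (+ c / suc i)))
           (ℚᵘ.+-congʳ (ℚ.toℚᵘ ½) (ℚᵘ.≃-trans (ℚ.toℚᵘ-homo‿- (+ c / suc i))
              (ℚᵘ.-‿cong (ℚ.toℚᵘ-fromℚᵘ (mkℚᵘ (+ c) i))))))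
         (ℚ.toℚᵘ-fromℚᵘ (mkℚᵘ (+ M) 0)) ⟩
  (mkℚᵘ (+ 1) 1 ℚᵘ.- mkℚᵘ (+ c) i) ℚᵘ.* mkℚᵘ (+ M) 0
    ≤⟨ *≤* (cross-multiplied c i M D h) ⟩
  mkℚᵘ (+ D) 0
    ≃⟨ ℚ.toℚᵘ-fromℚᵘ (mkℚᵘ (+ D) 0) ⟨
  ℚ.toℚᵘ (+ D / 1) ∎)
  where
  open ℚᵘ.≤-Reasoning

c/n⟶0 : ∀ c k → TendsToZero (λ N → + c / suc (N ∸ k))
-- The tolerance is `suc p` over `suc q`, hence at least 1 over `suc q`, so `N - k` at least
-- `c * suc q` suffices.
c/n⟶0 c k η@(mkℚ (+ suc p) q _) 0<η = k + c * suc q , λ N N₀≤N →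
  subst (ℚ._< η) (sym (ℚ.0≤p⇒∣p∣≡p (nonNeg N)))
    (ℚ.toℚᵘ-cancel-< (ℚᵘ.<-respˡ-≃ (ℚᵘ.≃-sym (ℚ.toℚᵘ-fromℚᵘ (mkℚᵘ (+ c) (N ∸ k)))) (*<* (cross N N₀≤N))))
  where
  nonNeg : ∀ N → 0ℚ ℚ.≤ + c / suc (N ∸ k)
  nonNeg N = ℚ.nonNegative⁻¹ _ {{ℚ.normalize-nonNeg c (suc (N ∸ k))}}
  cross : ∀ N → k + c * suc q ≤ N → + c ℤ.* + suc q ℤ.< + suc p ℤ.* + suc (N ∸ k)
  cross N N₀≤N = subst₂ ℤ._<_ (ℤ.pos-* c (suc q)) (ℤ.pos-* (suc p) (suc (N ∸ k))) (ℤ.+<+ (begin-strict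
    c * suc q              ≡⟨ m+n∸m≡n k (c * suc q) ⟨
    k + c * suc q ∸ k      ≤⟨ ∸-monoˡ-≤ k N₀≤N ⟩
    N ∸ k                  <⟨ n<1+n _ ⟩
    suc (N ∸ k)            ≤⟨ m≤n*m (suc (N ∸ k)) (suc p) ⟩
    suc p * suc (N ∸ k)    ∎))
    where open ≤-Reasoning
c/n⟶0 c k (mkℚ (+ 0) q _) (ℚ.*<* (ℤ.+<+ ()))
c/n⟶0 c k (mkℚ ℤ.-[1+ p ] q _) (ℚ.*<* ())

-- The number of edges of a tree

-- The list holds the vertices after the first, so that `u ∷ ws` lists all vertices of the path in
-- the format of `IsCycle`.
data Path {X : Set ℓ} (R : Rel X ℓ₁) : X → List X → X → Set (ℓ Level.⊔ ℓ₁) where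
  []  : ∀ {u} → Path R u [] u
  _∷_ : ∀ {u w v ws} → R u w → Path R w ws v → Path R u (w ∷ ws) v

module _ {X : Set ℓ} (_≟_ : DecidableEquality X) (R : Rel X ℓ₁) where

  open DecMembership _≟_ using (_∈?_)

  path-from : ∀ {u v x ws} → Path R u ws v → Unique (u ∷ ws) → x ∈ u ∷ ws →
              ∃[ xs ] Path R x xs v × Unique (x ∷ xs)
  path-from path       unique       (here refl) = _ , path , unique
  path-from (_ ∷ path) (_ ∷ unique) (there x∈)  = path-from path unique x∈

  -- Loop erasure: if the new first vertex already occurs on the simple path, only the part from
  -- that occurrence on is kept.
  simple-path : ∀ {u v} → Star R u v → ∃[ ws ] Path R u ws v × Unique (u ∷ ws)
  simple-path ε = [] , [] , [] ∷ []
  simple-path {u} (_◅_ {j = w} uRw walk) with ws , path , unique ← simple-path walk | u ∈? w ∷ ws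
  ... | yes u∈ = path-from path unique u∈
  ... | no  u∉ = w ∷ ws , uRw ∷ path , ¬Any⇒All¬ (w ∷ ws) u∉ ∷ unique

-- Two relations are involved because the path uses the old edges only, while the step that closes
-- it is a new edge.
closed-walk : ∀ {X : Set ℓ} {R R′ : Rel X ℓ₁} → (∀ {x y} → R x y → R′ x y) →
              ∀ {u v z ws} → Path R u ws v → R′ v z → Linked R′ ((u ∷ ws) ∷ʳ z)
closed-walk R⊆R′ []           vR′z = vR′z ∷ [-]
closed-walk R⊆R′ (uRw ∷ path) vR′z = R⊆R′ uRw ∷ closed-walk R⊆R′ path vR′z

𝟙 : {P : Set ℓ} → Dec P → ℕ
𝟙 P? = if does P? then 1 else 0

sum-𝟙≡ : (a : Fin n) → sum (λ x → 𝟙 (a Fin.≟ x)) ≡ 1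
sum-𝟙≡ {suc n} zero    = cong suc (∑.sum-replicate-zero n)
sum-𝟙≡ {suc n} (suc a) = sum-𝟙≡ a

-- For an idempotent map to representatives, this is the number of classes.
fixedPoints : (Fin n → Fin n) → ℕ
fixedPoints c = sum (λ x → 𝟙 (c x Fin.≟ x))

∣p∣≡0⇒p≡⊥ : (p : Subset n) → ∣ p ∣ ≡ 0 → p ≡ ⊥
∣p∣≡0⇒p≡⊥ []            eq = refl
∣p∣≡0⇒p≡⊥ (outside ∷ p) eq = cong (outside ∷_) (∣p∣≡0⇒p≡⊥ p eq)

∣p∣≡1⇒p≡⁅x⁆ : (p : Subset n) → ∣ p ∣ ≡ 1 → ∃[ x ] p ≡ ⁅ x ⁆
∣p∣≡1⇒p≡⁅x⁆ (inside  ∷ p) eq = zero , cong (inside ∷_) (∣p∣≡0⇒p≡⊥ p (suc-injective eq))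
∣p∣≡1⇒p≡⁅x⁆ (outside ∷ p) eq with x , refl ← ∣p∣≡1⇒p≡⁅x⁆ p eq = suc x , refl

∣p∣≡2⇒p≡⁅x⁆∪⁅y⁆ : (p : Subset n) → ∣ p ∣ ≡ 2 → ∃[ x ] ∃[ y ] p ≡ ⁅ x ⁆ ∪ ⁅ y ⁆
∣p∣≡2⇒p≡⁅x⁆∪⁅y⁆ (inside ∷ p) eq with y , refl ← ∣p∣≡1⇒p≡⁅x⁆ p (suc-injective eq) =
  zero , suc y , cong (inside ∷_) (sym (∪-identityˡ ⁅ y ⁆))
∣p∣≡2⇒p≡⁅x⁆∪⁅y⁆ (outside ∷ p) eq with x , y , refl ← ∣p∣≡2⇒p≡⁅x⁆∪⁅y⁆ p eq = suc x , suc y , refl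

∈pair : ∀ {x y u v : Fin n} → ⁅ x ⁆ ∪ ⁅ y ⁆ ≡ ⁅ u ⁆ ∪ ⁅ v ⁆ → x ≡ u ⊎ x ≡ v
∈pair {x = x} {y} {u} {v} eq
  with x∈p∪q⁻ ⁅ u ⁆ ⁅ v ⁆ (subst (x Subset.∈_) eq (x∈p∪q⁺ (inj₁ (x∈⁅x⁆ x))))
... | inj₁ x∈u = inj₁ (x∈⁅y⁆⇒x≡y u x∈u)
... | inj₂ x∈v = inj₂ (x∈⁅y⁆⇒x≡y v x∈v)

private
  variable
    es : List (Subset n)

-- Adjacency relative to a list of edges, so that a tree can be built up edge by edge.
Joined : List (Subset n) → Rel (Fin n) _
Joined es u v = (⁅ u ⁆ ∪ ⁅ v ⁆) ∈ es

Joined-sym : Symmetric (Joined es)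
Joined-sym {es = es} {u} {v} = subst (_∈ es) (∪-comm ⁅ u ⁆ ⁅ v ⁆)

Acyclic : List (Subset n) → Set
Acyclic es = ∀ v vs →
  ¬ (3 ≤ length (v ∷ vs) × Unique (v ∷ vs) × Linked (Joined es) ((v ∷ vs) ∷ʳ v))

-- A labelling of the vertices by representatives of the connected components.
record Components {n} (es : List (Subset n)) : Set where
  field
    rep     : Fin n → Fin n
    idem    : ∀ x → rep (rep x) ≡ rep x
    reach   : ∀ x → Star (Joined es) x (rep x)
    respect : ∀ {x y} → Joined es x y → rep x ≡ rep y
    count   : fixedPoints rep + length es ≡ n

discrete : Components {n} []
discrete {n} = record
  { rep     = id
  ; idem    = λ _ → refl
  ; reach   = λ _ → ε
  ; respect = λ ()
  ; count   = trans (+-identityʳ _) (fixedPoints-id n)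
  }
  where
  fixedPoints-id : ∀ n → fixedPoints (id {A = Fin n}) ≡ n
  fixedPoints-id zero    = refl
  fixedPoints-id (suc n) = cong suc (fixedPoints-id n)

module _ {n} {es : List (Subset n)} (K : Components es) {u v : Fin n}
         (separate : Components.rep K u ≢ Components.rep K v) where

  open Components K

  -- A union step: the new edge `uv` joins two components, and that of `u` adopts the representative
  -- of `v`.
  mergedRep : Fin n → Fin n
  mergedRep x with rep x Fin.≟ rep u
  ... | yes _ = rep v
  ... | no  _ = rep x

  private
    e = ⁅ u ⁆ ∪ ⁅ v ⁆

    mergedRep-yes : ∀ {x} → rep x ≡ rep u → mergedRep x ≡ rep v
    mergedRep-yes {x} eq with rep x Fin.≟ rep u
    ... | yes _  = refl
    ... | no neq = contradiction eq neq

    mergedRep-no : ∀ {x} → rep x ≢ rep u → mergedRep x ≡ rep x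
    mergedRep-no {x} neq with rep x Fin.≟ rep u
    ... | yes eq = contradiction eq neq
    ... | no _   = refl

    mergedRep-u : mergedRep u ≡ rep v
    mergedRep-u = mergedRep-yes refl

    mergedRep-v : mergedRep v ≡ rep v
    mergedRep-v = mergedRep-no (separate ∘ sym)

    mergedRep-idem : ∀ x → mergedRep (mergedRep x) ≡ mergedRep x
    mergedRep-idem x with rep x Fin.≟ rep u
    ... | yes _  = trans (mergedRep-no λ eq → separate (sym (trans (sym (idem v)) eq))) (idem v)
    ... | no neq = trans (mergedRep-no λ eq → neq (trans (sym (idem x)) eq)) (idem x)

    older : ∀ {x y} → Star (Joined es) x y → Star (Joined (e ∷ es)) x y
    older = Star.map there

    mergedRep-reach : ∀ x → Star (Joined (e ∷ es)) x (mergedRep x)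
    mergedRep-reach x with rep x Fin.≟ rep u
    ... | no _   = older (reach x)
    -- The walk goes from `x` to `rep u`, back to `u`, over the new edge to `v` and on to `rep v`.
    ... | yes eq = older (reach x) ◅◅
      subst (λ z → Star (Joined (e ∷ es)) z u) (sym eq) (Star.reverse (Joined-sym {es = e ∷ es}) (older (reach u)))
      ◅◅ (here refl ◅ older (reach v))

    mergedRep-cong : ∀ {x y} → rep x ≡ rep y → mergedRep x ≡ mergedRep y
    mergedRep-cong {x} {y} eq with rep x Fin.≟ rep u | rep y Fin.≟ rep u
    ... | yes _ | yes _   = refl
    ... | yes p | no ¬p   = contradiction (trans (sym eq) p) ¬p
    ... | no ¬p | yes p   = contradiction (trans eq p) ¬p
    ... | no _  | no _    = eq

    mergedRep-pair : ∀ {x} → x ≡ u ⊎ x ≡ v → mergedRep x ≡ rep v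
    mergedRep-pair (inj₁ refl) = mergedRep-u
    mergedRep-pair (inj₂ refl) = mergedRep-v

    mergedRep-respect : ∀ {x y} → Joined (e ∷ es) x y → mergedRep x ≡ mergedRep y
    mergedRep-respect {x} {y} (here eq) =
      trans (mergedRep-pair (∈pair eq)) (sym (mergedRep-pair (∈pair (trans (∪-comm ⁅ y ⁆ ⁅ x ⁆) eq))))
    mergedRep-respect (there joined) = mergedRep-cong (respect joined)

    -- Exactly one fixed point, rep u, is lost.
    mergedRep-fixed : ∀ x → 𝟙 (rep x Fin.≟ x) ≡ 𝟙 (rep u Fin.≟ x) + 𝟙 (mergedRep x Fin.≟ x)
    mergedRep-fixed x with rep x Fin.≟ x | rep u Fin.≟ x | mergedRep x Fin.≟ x
    ... | yes _  | yes _   | no _   = refl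
    ... | yes _  | no _    | yes _  = refl
    ... | no _   | no _    | no _   = refl
    ... | yes p  | yes q   | yes r  = contradiction
      (trans q (trans (sym r) (mergedRep-yes (trans p (sym q))))) separate
    ... | yes p  | no ¬q   | no ¬r  = contradiction
      (trans (mergedRep-no λ eq → ¬q (trans (sym eq) p)) p) ¬r
    ... | no ¬p  | yes q   | _      = contradiction
      (trans (cong rep (sym q)) (trans (idem u) q)) ¬p
    ... | no ¬p  | no ¬q   | yes r  with rep x Fin.≟ rep u
    ...   | yes _ = contradiction (trans (cong rep (sym r)) (trans (idem v) r)) ¬p
    ...   | no _  = contradiction r ¬p

    mergedRep-count : fixedPoints mergedRep + suc (length es) ≡ n
    mergedRep-count = begin
      fixedPoints mergedRep + suc (length es)
        ≡⟨ +-suc (fixedPoints mergedRep) (length es) ⟩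
      1 + fixedPoints mergedRep + length es
        ≡⟨ cong (λ z → z + fixedPoints mergedRep + length es) (sum-𝟙≡ (rep u)) ⟨
      sum (λ x → 𝟙 (rep u Fin.≟ x)) + fixedPoints mergedRep + length es
        ≡⟨ cong (_+ length es) (∑.∑-distrib-+ (λ x → 𝟙 (rep u Fin.≟ x)) (λ x → 𝟙 (mergedRep x Fin.≟ x))) ⟨
      sum (λ x → 𝟙 (rep u Fin.≟ x) + 𝟙 (mergedRep x Fin.≟ x)) + length es
        ≡⟨ cong (_+ length es) (∑.sum-cong-≗ mergedRep-fixed) ⟨
      fixedPoints rep + length es
        ≡⟨ count ⟩
      n ∎
      where open ≡-Reasoning

  merge : Components ((⁅ u ⁆ ∪ ⁅ v ⁆) ∷ es)
  merge = record
    { rep     = mergedRep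
    ; idem    = mergedRep-idem
    ; reach   = mergedRep-reach
    ; respect = mergedRep-respect
    ; count   = mergedRep-count
    }

-- A simple path from `u` to `v` along old edges has at least two edges, as `u ≢ v` and `uv` is new;
-- the edge `uv` then closes it to a cycle.
acyclic⇒separate : ∀ {es : List (Subset n)} {u v} → Acyclic ((⁅ u ⁆ ∪ ⁅ v ⁆) ∷ es) →
  (⁅ u ⁆ ∪ ⁅ v ⁆) ∉ es → u ≢ v → ¬ Star (Joined es) u v
acyclic⇒separate {es = es} {u} {v} acyclic new u≢v walk
  with simple-path Fin._≟_ (Joined es) walk
... | []         , []        , _      = u≢v refl
... | _ ∷ []     , (uv ∷ []) , _      = new uv
... | w ∷ x ∷ ws , path      , unique = acyclic u (w ∷ x ∷ ws)
  (s≤s (s≤s (s≤s z≤n)) , unique , closed-walk there path (here (∪-comm ⁅ v ⁆ ⁅ u ⁆)))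

-- By acyclicity each edge joins two different components of the edges after it in the list, so
-- every addition is a `merge`.
components : (es : List (Subset n)) → Unique es → All (λ e → ∣ e ∣ ≡ 2) es → Acyclic es →
             Components es
components []       _              _             _       = discrete
components (e ∷ es) (new ∷ unique) (∣e∣≡2 ∷ sizes) acyclic
  with u , v , refl ← ∣p∣≡2⇒p≡⁅x⁆∪⁅y⁆ e ∣e∣≡2 =
  merge K separate
  where
  K = components es unique sizes λ x xs (long , distinct , linked) →
        acyclic x xs (long , distinct , Linked.map there linked)
  open Components K
  u≢v : u ≢ v
  u≢v refl with () ← trans (sym ∣e∣≡2) (trans (cong ∣_∣ (∪-idem ⁅ u ⁆)) (∣⁅x⁆∣≡1 u))
  separate : rep u ≢ rep v
  separate eq = acyclic⇒separate acyclic (All¬⇒¬Any new) u≢v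
    (reach u ◅◅ subst (λ z → Star (Joined es) z v) (sym eq) (Star.reverse (Joined-sym {es = es}) (reach v)))

-- Connectedness makes `rep` constant, so there is one component, and `count` gives the number of
-- edges.
tree-size : (T : Graph n) → IsTree T → suc (length (edges T)) ≡ n
tree-size {zero}  T tree with () ← IsTree.nonempty tree
tree-size {suc n} T tree = trans (cong (_+ length (edges T)) (sym one)) count
  where
  open Components (components (edges T) (unique T) (uniform T) (IsTree.acyclic tree))
  constant : ∀ {x y} → Star (Joined (edges T)) x y → rep x ≡ rep y
  constant ε             = refl
  constant (xy ◅ walk) = trans (respect xy) (constant walk)
  one : fixedPoints rep ≡ 1
  one = trans (∑.sum-cong-≗ λ x → cong (λ z → 𝟙 (z Fin.≟ x)) (constant (IsTree.connected tree x zero)))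
              (sum-𝟙≡ (rep zero))

-- Spanning embeddings and parity

-- By the pigeonhole principle: punching out a missed value would give an injection into a smaller
-- set.
injective⇒surjective : {φ : Fin n → Fin n} → Injective _≡_ _≡_ φ → ∀ y → ∃[ x ] φ x ≡ y
injective⇒surjective {n = suc n} {φ} inj y with any? (λ x → φ x Fin.≟ y)
... | yes found = found
... | no missed = contradiction
  (injective⇒≤ {f = λ x → punchOut (avoids x)} λ eq → inj (punchOut-injective (avoids _) (avoids _) eq))
  (<⇒≱ (n<1+n n))
  where
  avoids : ∀ x → y ≢ φ x
  avoids x eq = missed (x , sym eq)

injective⇒permutation : {φ : Fin n → Fin n} → Injective _≡_ _≡_ φ → Permutation n n
injective⇒permutation {φ = φ} inj = permutation φ (proj₁ ∘ injective⇒surjective inj)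
  (proj₂ ∘ injective⇒surjective inj) (λ x → inj (proj₂ (injective⇒surjective inj (φ x))))

lookup-image : (φ : Fin m → Fin n) → Injective _≡_ _≡_ φ → ∀ S x → lookup (image φ S) (φ x) ≡ lookup S x
lookup-image φ inj S x = trans (lookup∘tabulate _ (φ x)) found
  where
  preimage? = any? λ x′ → (x′ Subset.∈? S) ×-dec (φ x′ Fin.≟ φ x)
  found : does preimage? ≡ lookup S x
  found with lookup S x in eq
  ... | true  = dec-true preimage? (x , lookup⇒[]= x S eq , refl)
  ... | false = dec-false preimage? λ (x′ , x′∈S , φx′≡φx) →
    contradiction (trans (sym eq) ([]=⇒lookup (subst (Subset._∈ S) (inj φx′≡φx) x′∈S))) λ ()

parity-image : (φ : Fin n → Fin n) → Injective _≡_ _≡_ φ → ∀ S A →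
  parity (image φ S ∩ A) ≡ ⨁ (λ x → lookup S x ∧ lookup A (φ x))
parity-image φ inj S A = begin
  ⨁ (lookup (image φ S ∩ A))
    ≡⟨ ⊕.sum-cong-≗ (λ y → lookup-zipWith _∧_ y (image φ S) A) ⟩
  ⨁ (λ y → lookup (image φ S) y ∧ lookup A y)
    ≡⟨ ⊕.sum-permute (λ y → lookup (image φ S) y ∧ lookup A y) (injective⇒permutation inj) ⟩
  ⨁ (λ x → lookup (image φ S) (φ x) ∧ lookup A (φ x))
    ≡⟨ ⊕.sum-cong-≗ (λ x → cong (_∧ lookup A (φ x)) (lookup-image φ inj S x)) ⟩
  ⨁ (λ x → lookup S x ∧ lookup A (φ x)) ∎
  where open ≡-Reasoning

-- Exchanging the sums over edges and vertices counts each vertex `x` with `φ x` in `A` an odd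
-- number of times. The equation `m ≡ n` makes `φ` a bijection, so these images run through all of
-- `A`.
parity-double-count : ∀ {L} (es : Fin L → Subset m) (φ : Fin m → Fin n) → Injective _≡_ _≡_ φ → m ≡ n →
  (∀ x → ⨁ (λ i → lookup (es i) x) ≡ true) →
  ∀ A → ⨁ (λ i → parity (image φ (es i) ∩ A)) ≡ parity A
parity-double-count es φ inj refl odd A = begin
  ⨁ (λ i → parity (image φ (es i) ∩ A))
    ≡⟨ ⊕.sum-cong-≗ (λ i → parity-image φ inj (es i) A) ⟩
  ⨁ (λ i → ⨁ (λ x → lookup (es i) x ∧ lookup A (φ x)))
    ≡⟨ ⊕.∑-comm (λ i x → lookup (es i) x ∧ lookup A (φ x)) ⟩
  ⨁ (λ x → ⨁ (λ i → lookup (es i) x ∧ lookup A (φ x)))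
    ≡⟨ ⊕.sum-cong-≗ (λ x → ⊕.*-distribʳ-sum (lookup A (φ x)) (λ i → lookup (es i) x)) ⟨
  ⨁ (λ x → ⨁ (λ i → lookup (es i) x) ∧ lookup A (φ x))
    ≡⟨ ⊕.sum-cong-≗ (λ x → cong (_∧ lookup A (φ x)) (odd x)) ⟩
  ⨁ (λ x → lookup A (φ x))
    ≡⟨ ⊕.sum-permute (lookup A) (injective⇒permutation inj) ⟨
  parity A ∎
  where open ≡-Reasoning

-- The image of `n` in the two-element field, written as a sum of ones to agree with `⨁` over
-- constant families.
isOdd : ℕ → Bool
isOdd n = ⨁ {n} (λ _ → true)

¬isOdd⇒2∣ : ∀ n → isOdd n ≡ false → 2 ∣ n
¬isOdd⇒2∣ zero          _  = divides-refl 0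
¬isOdd⇒2∣ (suc (suc n)) eq with divides q refl ← ¬isOdd⇒2∣ n (trans (sym (not-involutive (isOdd n))) eq) =
  divides-refl (suc q)

¬2∣⇒isOdd : ∀ n → ¬ (2 ∣ n) → isOdd n ≡ true
¬2∣⇒isOdd n ¬2∣n with isOdd n in eq
... | true  = refl
... | false = contradiction (¬isOdd⇒2∣ n eq) ¬2∣n

⨁-const : ∀ n b → isOdd n ≡ true → ⨁ {n} (λ _ → b) ≡ b
⨁-const n true  odd = odd
⨁-const n false odd = ⊕.sum-replicate-zero n

⁅x⁆⊆?p≡lookup : ∀ x (p : Subset n) → does (⁅ x ⁆ ⊆? p) ≡ lookup p x
⁅x⁆⊆?p≡lookup x p with lookup p x in eq
... | true  = dec-true (⁅ x ⁆ ⊆? p) λ y∈ → subst (Subset._∈ p) (sym (x∈⁅y⁆⇒x≡y x y∈)) (lookup⇒[]= x p eq)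
... | false = dec-false (⁅ x ⁆ ⊆? p) λ x⊆p → contradiction (trans (sym eq) ([]=⇒lookup (x⊆p (x∈⁅x⁆ x)))) λ ()

isOdd-degree : ∀ v (es : List (Subset n)) →
  ⨁ (λ i → lookup (List.lookup es i) v) ≡ isOdd (length (filter (⁅ v ⁆ ⊆?_) es))
isOdd-degree v []       = refl
isOdd-degree v (e ∷ es) with lookup e v | ⁅x⁆⊆?p≡lookup v e
... | true  | eq rewrite eq = cong not (isOdd-degree v es)
... | false | eq rewrite eq = isOdd-degree v es

lookup-blowUp : ∀ r (S : Subset m) i j → lookup (blowUp r S) (combine i j) ≡ lookup S i
lookup-blowUp r S i j = begin
  lookup (concat (Vec.map (replicate r) S)) (combine i j)  ≡⟨ lookup-concat (Vec.map (replicate r) S) i j ⟩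
  lookup (lookup (Vec.map (replicate r) S) i) j            ≡⟨ cong (λ xs → lookup xs j) (lookup-map i (replicate r) S) ⟩
  lookup (replicate r (lookup S i)) j                      ≡⟨ lookup-replicate j (lookup S i) ⟩
  lookup S i                                               ∎
  where open ≡-Reasoning

⨁-singletons : (y : Fin m) → ⨁ (λ i → lookup ⁅ i ⁆ y) ≡ true
⨁-singletons {suc m} zero = cong not (⊕.sum-replicate-zero m)
⨁-singletons (suc y) = trans (cong (_xor ⨁ (λ i → lookup ⁅ i ⁆ y)) (lookup-replicate y false)) (⨁-singletons y)

-- A vertex of `T` keeps its odd degree, and a new vertex lies in exactly one edge, the one that
-- received its block.
expansion-odd : ∀ k (T : Graph n) → AllDegreesOdd T → ∀ x → ⨁ (λ i → lookup (expansionEdge k T i) x) ≡ true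
expansion-odd {n} k T odd x = trans
  (⊕.sum-cong-≗ λ i → lookup-splitAt n (List.lookup (edges T) i) (blowUp (k ∸ 2) ⁅ i ⁆) x) (bySide (splitAt n x))
  where
  bySide : ∀ s → ⨁ (λ i → [ lookup (List.lookup (edges T) i) , lookup (blowUp (k ∸ 2) ⁅ i ⁆) ]′ s) ≡ true
  bySide (inj₁ v) = trans (isOdd-degree v (edges T)) (¬2∣⇒isOdd _ (odd v))
  bySide (inj₂ y) with i′ , j , refl ← combine-surjective {length (edges T)} {k ∸ 2} y = trans
    (⊕.sum-cong-≗ λ i → lookup-blowUp (k ∸ 2) ⁅ i ⁆ i′ j) (⨁-singletons i′)

-- This is what makes every embedding of the expansion spanning. Adding `k` to both sides removes
-- the truncated subtraction.
expansion-order : ∀ {L} → 2 ≤ k → suc L ≡ n → n + L * (k ∸ 2) ≡ spanningOrder k n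
expansion-order {suc (suc r)} {L = L} (s≤s (s≤s _)) refl = begin
  suc L + L * r                          ≡⟨ m+n∸m≡n (2 + r) (suc L + L * r) ⟨
  2 + r + (suc L + L * r) ∸ (2 + r)      ≡⟨ cong (_∸ (2 + r)) (lem r L) ⟩
  (1 + r) * suc L + 2 ∸ (2 + r)          ∎
  where
  open ≡-Reasoning
  lem : ∀ r L → 2 + r + (suc L + L * r) ≡ (1 + r) * suc L + 2
  lem = solve-∀

odd-size : ∀ L → 2 ∣ suc L → isOdd L ≡ true
odd-size L 2∣1+L = ¬2∣⇒isOdd L λ 2∣L →
  contradiction (∣⇒≤ (∣m+n∣m⇒∣n (subst (2 ∣_) (+-comm 1 L) 2∣1+L) 2∣L)) λ { (s≤s ()) }

not-contained : ∀ {k} (2≤k : 2 ≤ k) (A : Subset (spanningOrder k n)) → 2 ∣ n →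
  (T : Graph n) → IsTree T → AllDegreesOdd T →
  ¬ Contains (parityGraph k A (not (parity A))) (expansion 2≤k T)
not-contained {k = k} 2≤k A 2∣n T tree odd (φ , inj , φ-edge) = not-¬ refl (begin
  parity A
    ≡⟨ parity-double-count (expansionEdge k T) φ inj (expansion-order 2≤k size) (expansion-odd k T odd) A ⟨
  ⨁ (λ i → parity (image φ (expansionEdge k T i) ∩ A))
    ≡⟨ ⊕.sum-cong-≗ (λ i → proj₂ (proj₂ (∈-filter⁻ (parityEdge? k A (not (parity A)))
         {xs = allSubsets _} (φ-edge _ (∈-tabulate⁺ {f = expansionEdge k T} i))))) ⟩
  ⨁ {length (edges T)} (λ _ → not (parity A))
    ≡⟨ ⨁-const (length (edges T)) (not (parity A)) (odd-size (length (edges T)) (subst (2 ∣_) (sym size) 2∣n)) ⟩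
  not (parity A) ∎)
  where
  open ≡-Reasoning
  size = tree-size T tree

-- Codegree bound for every order and conclusion

m<n⇒n≡m+[1+o] : m < n → ∃[ o ] n ≡ m + suc o
m<n⇒n≡m+[1+o] {m} {n} m<n = n ∸ suc m , sym (trans (+-suc m (n ∸ suc m)) (m+[n∸m]≡n m<n))

scaled-δ-bound : ∀ {d} → d < k → ∀ N b → let M = (N ∸ d) C (k ∸ d) in
  suc (N ∸ k) * M ≤
  2 * (suc (N ∸ k) * δ d (parityGraph k (alternating N) b)) + 2 * ((2 ^ d * (k ∸ d)) * M)
scaled-δ-bound {k} {d} d<k N b with k ≤? N
-- For `N < k` the binomial coefficient vanishes, and with it the left side.
... | no k≰N = ≤-trans (≤-reflexive (trans (cong (suc (N ∸ k) *_) none) (*-zeroʳ (suc (N ∸ k))))) z≤n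
  where
  none : (N ∸ d) C (k ∸ d) ≡ 0
  none = k>n⇒nCk≡0 (m<n+o⇒m∸n<o N d {{>-nonZero (m<n⇒0<n∸m d<k)}}
    (subst (N <_) (sym (m+[n∸m]≡n (<⇒≤ d<k))) (≰⇒> k≰N)))
... | yes k≤N with j , refl ← m<n⇒n≡m+[1+o] d<k rewrite m+n∸m≡n d (suc j) = subst
  (λ N′ → let M = (N′ ∸ d) C suc j in
     suc (N ∸ k) * M ≤ 2 * (suc (N ∸ k) * δ d (parityGraph k (alternating N′) b)) + 2 * ((2 ^ d * suc j) * M))
  (m∸n+n≡m k≤N) (δ-bound d j (N ∸ k) b)

theorem3p3 : (k d : ℕ) (1≤d : 1 ≤ d) (d<k : d < k) →
    Σ[ f ∈ (ℕ → ℚ) ]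
    (TendsToZero f ×
    ((n : ℕ) → 1 ≤ n → 2 ∣ n →
    let N = spanningOrder k n in
    Σ[ H ∈ KGraph k N ]
    (((½ ℚ.- f N) ℚ.* (+ ((N ∸ d) C (k ∸ d)) / 1) ℚ.≤ (+ δ d H / 1)) ×
    ((T : Graph n) → IsTree T → AllDegreesOdd T →
    ¬ Contains H (expansion (≤-trans (s≤s 1≤d) d<k) T)))))
theorem3p3 k d 1≤d d<k =
  -- The relative error found in `δ-bound`; `suc` keeps the denominator positive for every `N`.
  (λ N → + (2 ^ d * (k ∸ d)) / suc (N ∸ k)) ,
  c/n⟶0 (2 ^ d * (k ∸ d)) k ,
  λ n _ 2∣n →
    let N = spanningOrder k n
        A = alternating N
        b = not (parity A)
        H = parityGraph k A b
    in
    H ,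
    ½-x-bound (2 ^ d * (k ∸ d)) (N ∸ k) ((N ∸ d) C (k ∸ d)) (δ d H) (scaled-δ-bound d<k N b) ,
    not-contained (≤-trans (s≤s 1≤d) d<k) A 2∣n
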